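{- Let $n\ge 2$ be an integer, let $\mathrm{PPF}_n$ be the set of prime parking functions of length $n$, and for $\pi\in \mathrm{PPF}_n$ let $\mathrm{fix}(\pi)$ be the number of fixed points of $\pi$. Then, as polynomials in the indeterminate $q$, $$\sum_{\pi\in \mathrm{PPF}_n} q^{\mathrm{fix}(\pi)}=(q+n-2)^{n-1}.$$
   Context: A parking function of length $n$ is a sequence $\pi=(\pi_1,\dots,\pi_n)$ of positive integers such that, if $\lambda_1\le\cdots\le\lambda_n$ is the weakly increasing rearrangement of $\pi_1,\dots,\pi_n$, then $\lambda_i\le i$ for all $1\le i\le n$. A parking function $\pi$ of length $n$ is prime if for all $1\le j\le n-1$ one has $\#\{i: \pi_i\le j\}\ge j+1$. An index $i\in\{1,\dots,n\}$ is a fixed point of $\pi$ if $\pi_i=i$. -}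

module Defs where

open import Algebra.Bundles using (RawSemiring)
open import Data.Fin.Base using (Fin; toℕ)
open import Data.Fin.Properties using (all?; toℕ<n)
open import Data.Integer.Base as ℤ using (ℤ; 0ℤ; 1ℤ)
open import Data.List.Base as List using (List; []; _∷_; length; upTo; cartesianProductWith; filter; foldr)
open import Data.List.Membership.Propositional using (_∈_)
open import Data.List.Membership.Propositional.Properties using (∈-map⁺; ∈-upTo⁺; ∈-cartesianProductWith⁺; ∈-filter⁺; ∈-filter⁻)
open import Data.List.Relation.Binary.Permutation.Propositional using (↭-sym)
open import Data.List.Relation.Binary.Permutation.Propositional.Properties using (∈-resp-↭; ↭-length)
open import Data.List.Relation.Unary.All using ([])
open import Data.List.Relation.Unary.AllPairs using ([]; _∷_)
open import Data.List.Relation.Unary.Any using (here; index)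
open import Data.List.Relation.Unary.Any.Properties using (lookup-index)
open import Data.List.Relation.Unary.Unique.Propositional using (Unique)
import Data.List.Relation.Unary.Unique.Propositional.Properties as Unique
open import Data.Nat.Base using (ℕ; zero; suc; _≤_; _∸_; s≤s; s≤s⁻¹)
open import Data.Nat.Properties using (_≤?_; _≟_; allUpTo?; ≤-totalOrder; ≤-decTotalOrder; ≤-trans; ≤-reflexive; suc-injective)
open import Data.List.Sort.InsertionSort ≤-decTotalOrder using (insertionSort)
open import Data.List.Sort.Base ≤-totalOrder using (module SortingAlgorithm)
open SortingAlgorithm insertionSort using (sort; sort-↭)
open import Data.Product.Base using (_×_; _,_; proj₁; proj₂)
open import Data.Vec.Base as Vec using (Vec; []; _∷_; lookup; toList; allFin; count)
open import Data.Vec.Membership.Propositional.Properties using (∈-lookup; ∈-toList⁺)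
open import Data.Vec.Properties using (∷-injective; length-toList)
open import Function.Base using (_∘_)
open import Function.Bundles using (_⇔_; mk⇔)
open import Level using (0ℓ)
open import Relation.Binary.PropositionalEquality using (_≡_; refl; sym; trans; subst)
open import Relation.Nullary.Decidable using (Dec; map′; _×-dec_; _→-dec_)
open import Relation.Unary using (Pred; Decidable)

private
  variable
    n : ℕ

-- Positions are elements i of Fin n, counted from 0; the 1-based index of the
-- position i is suc (toℕ i).

#_ : {P : Pred (Fin n) 0ℓ} → Decidable P → ℕ
# P? = count P? (allFin _)

-- The list sort (toList π) has length n, but only propositionally, so its
-- positions are indexed by its own length.
IsParking : Vec ℕ n → Set
IsParking {n} π =
  (∀ (i : Fin n) → 1 ≤ lookup π i) ×
  (let ƛ = sort (toList π) in ∀ (i : Fin (length ƛ)) → List.lookup ƛ i ≤ suc (toℕ i))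

IsPrimeParking : Vec ℕ n → Set
IsPrimeParking {n} π =
  IsParking π ×
  (∀ j → 1 ≤ j → j ≤ n ∸ 1 → suc j ≤ # (λ i → lookup π i ≤? j))

fix : Vec ℕ n → ℕ
fix π = # (λ i → lookup π i ≟ suc (toℕ i))

isParking? : (π : Vec ℕ n) → Dec (IsParking π)
isParking? π = all? (λ i → 1 ≤? lookup π i) ×-dec all? (λ i → _ ≤? suc (toℕ i))

isPrimeParking? : (π : Vec ℕ n) → Dec (IsPrimeParking π)
isPrimeParking? {n} π = isParking? π ×-dec
  map′ (λ h j 1≤j j≤n-1 → h (s≤s j≤n-1) 1≤j) (λ h {j} j≤n-1 1≤j → h j 1≤j (s≤s⁻¹ j≤n-1))
    (allUpTo? (λ j → (1 ≤? j) →-dec (suc j ≤? # (λ i → lookup π i ≤? j))) (suc (n ∸ 1)))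

words : List ℕ → (m : ℕ) → List (Vec ℕ m)
words xs zero    = [] ∷ []
words xs (suc m) = cartesianProductWith _∷_ xs (words xs m)

-- The finite set of prime parking functions, as a list.  Searching only words
-- with letters 1, …, n loses nothing: see ∈-PPF and PPF-unique.
PPF : (n : ℕ) → List (Vec ℕ n)
PPF n = filter isPrimeParking? (words (List.map suc (upTo n)) n)

∈-words : ∀ {xs m} (π : Vec ℕ m) → (∀ i → lookup π i ∈ xs) → π ∈ words xs m
∈-words []      h = here refl
∈-words (x ∷ π) h =
  ∈-cartesianProductWith⁺ _∷_ (h Fin.zero) (∈-words π (h ∘ Fin.suc))

words-unique : ∀ {xs} → Unique xs → ∀ m → Unique (words xs m)
words-unique u zero    = [] ∷ []
words-unique u (suc m) =
  Unique.cartesianProductWith⁺ _∷_ ∷-injective u (words-unique u m)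

parking⇒≤n : (π : Vec ℕ n) → IsParking π → ∀ i → lookup π i ≤ n
parking⇒≤n {n} π (_ , λ≤) i =
  subst (_≤ n) (sym (lookup-index πᵢ∈)) (≤-trans (λ≤ k) (≤-trans (toℕ<n k) (≤-reflexive len)))
  where
  πᵢ∈ : lookup π i ∈ sort (toList π)
  πᵢ∈ = ∈-resp-↭ (↭-sym (sort-↭ (toList π))) (∈-toList⁺ (∈-lookup i π))
  k = index πᵢ∈
  len : length (sort (toList π)) ≡ n
  len = trans (↭-length (sort-↭ (toList π))) (length-toList π)

∈-PPF : {π : Vec ℕ n} → π ∈ PPF n ⇔ IsPrimeParking π
∈-PPF {n} {π} = mk⇔
  (λ π∈ → proj₂ (∈-filter⁻ isPrimeParking? {xs = words _ n} π∈))
  (λ p → ∈-filter⁺ isPrimeParking? (∈-words π (λ i → letter (proj₁ (proj₁ p) i) (parking⇒≤n π (proj₁ p) i))) p)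
  where
  letter : ∀ {x} → 1 ≤ x → x ≤ n → x ∈ List.map suc (upTo n)
  letter {suc x} _ x<n = ∈-map⁺ suc (∈-upTo⁺ x<n)

PPF-unique : ∀ n → Unique (PPF n)
PPF-unique n = Unique.filter⁺ isPrimeParking?
  (words-unique (Unique.map⁺ suc-injective (Unique.upTo⁺ n)) n)

-- Polynomials in one indeterminate q over ℤ: a₀ ∷ a₁ ∷ … stands for
-- a₀ + a₁ q + ….  Trailing zeros are allowed, so equality is equality of all
-- coefficients.
Poly : Set
Poly = List ℤ

coeff : Poly → ℕ → ℤ
coeff []      _       = 0ℤ
coeff (a ∷ p) zero    = a
coeff (a ∷ p) (suc k) = coeff p k

infix  4 _≈_
infixl 6 _+ₚ_
infixl 7 _*ₚ_

_≈_ : Poly → Poly → Set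
p ≈ r = ∀ k → coeff p k ≡ coeff r k

const : ℤ → Poly
const a = a ∷ []

q : Poly
q = 0ℤ ∷ 1ℤ ∷ []

_+ₚ_ : Poly → Poly → Poly
[]      +ₚ r       = r
(a ∷ p) +ₚ []      = a ∷ p
(a ∷ p) +ₚ (b ∷ r) = (a ℤ.+ b) ∷ (p +ₚ r)

-- (a + q p) r = a r + q (p r)
_*ₚ_ : Poly → Poly → Poly
[]      *ₚ r = []
(a ∷ p) *ₚ r = List.map (a ℤ.*_) r +ₚ (0ℤ ∷ (p *ₚ r))

ℤ[q] : RawSemiring 0ℓ 0ℓ
ℤ[q] = record
  { Carrier = Poly ; _≈_ = _≈_ ; _+_ = _+ₚ_ ; _*_ = _*ₚ_ ; 0# = [] ; 1# = const 1ℤ }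

open import Algebra.Definitions.RawSemiring ℤ[q] public using (_^_)

∑ : {A : Set} → List A → (A → Poly) → Poly
∑ xs f = foldr _+ₚ_ [] (List.map f xs)

infix 5 ∑
syntax ∑ xs (λ x → e) = ∑[ x ← xs ] e

-- Put m = n − 1.  All letters of a prime parking function of length n are at
-- most m, so consider the words of length n over {1, …, m}.  The cyclic group
-- ℤ/m acts on them by rotating the letters and, simultaneously, the first m
-- positions; position n is never fixed, so the action preserves the number of
-- fixed points.  By the cycle lemma each word has exactly one prime parking
-- function among its m rotations: the one that starts after the last minimum
-- on [0, m] of u ↦ #{i : πᵢ ≤ u} − u.  Hence m times the sum over prime
-- parking functions is the sum over all words, which factors over positions as
-- (q + m − 1)^m · m.

module Submission where

open import Defs
open import Data.Nat.Base using (ℕ; zero; suc; pred; _+_; _*_; _∸_; _≤_; _<_; z≤n; s≤s; s≤s⁻¹)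
open import Data.Nat.Properties as ℕ using (_<?_; _≤?_)
import Data.Nat.Tactic.RingSolver as ℕSolver
open import Data.Integer.Base using (+_; _-_; 0ℤ; 1ℤ) renaming (_+_ to _+ᶻ_; _*_ to _*ᶻ_; suc to sucᶻ)
import Data.Integer.Properties as ℤ
import Data.Integer.Tactic.RingSolver as ℤSolver
open import Algebra.Properties.CommutativeMonoid.Sum ℕ.+-0-commutativeMonoid using (sum; sum-cong-≗; sum-permute; ∑-distrib-+)
open import Data.Bool.Base using (if_then_else_; true; false)
open import Data.Fin.Base as Fin using (Fin; toℕ; fromℕ; fromℕ<; inject₁)
open import Data.Fin.Permutation as Permutation using (Permutation; _⟨$⟩ʳ_)
open import Data.Fin.Properties using (toℕ<n; toℕ-fromℕ<; toℕ-injective; toℕ-inject₁; toℕ-fromℕ)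
open import Data.List.Base as List using (List; []; _∷_; _++_; length; map; cartesianProductWith; cartesianProduct; filter; upTo)
open import Data.List.Membership.Propositional using (_∈_; _∉_)
open import Data.List.Membership.Propositional.Properties using (∈-map⁺; ∈-map⁻; ∈-upTo⁺; ∈-upTo⁻; ∈-cartesianProduct⁺; ∈-cartesianProduct⁻; ∈-cartesianProductWith⁻)
open import Data.List.Membership.Propositional.Properties.WithK using (unique∧set⇒bag)
open import Data.List.Properties using (filter-accept; filter-none; length-map; length-upTo)
open import Data.List.Relation.Binary.BagAndSetEquality using (∼bag⇒↭)
open import Data.List.Relation.Binary.Permutation.Propositional as Perm using (_↭_; ↭-sym)
open import Data.List.Relation.Binary.Permutation.Propositional.Properties using (filter-↭; ↭-length)
open import Data.List.Relation.Unary.All as All using ([]; _∷_)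
import Data.List.Relation.Unary.All.Properties as All
open import Data.List.Relation.Unary.AllPairs using (AllPairs; []; _∷_)
open import Data.List.Relation.Unary.Any using (here; there)
open import Data.List.Relation.Unary.Linked.Properties using (Linked⇒AllPairs)
open import Data.List.Relation.Unary.Unique.Propositional using (Unique)
import Data.List.Relation.Unary.Unique.Propositional.Properties as Unique
open import Data.List.Sort.InsertionSort ℕ.≤-decTotalOrder using (insertionSort)
open import Data.List.Sort.Base ℕ.≤-totalOrder using (module SortingAlgorithm)
open SortingAlgorithm insertionSort using (sort; sort-↭; sort-↗)
open import Data.Product.Base using (_×_; _,_; proj₁; proj₂; ∃-syntax)
open import Data.Sum.Base using (inj₁; inj₂)
open import Data.Vec.Base using (Vec; []; _∷_; lookup; tabulate; allFin; count; toList)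
open import Data.Vec.Properties using (lookup∘tabulate; tabulate∘lookup; tabulate-cong; length-toList; count≤n)
open import Function.Base using (_∘_; id)
open import Function.Bundles using (_⇔_; mk⇔; Equivalence)
open import Level using (0ℓ)
open import Relation.Binary.PropositionalEquality
open import Relation.Nullary.Decidable using (Dec; yes; no; does; dec-true; dec-false; does-⇔)
open import Relation.Nullary.Negation using (¬_; contradiction)
open import Relation.Unary using (Pred; Decidable)

private
  variable
    A B : Set
    n : ℕ

-- Lists without repetition

-- Injectivity is asked on entries only, because `unrotate`, to which this is applied in the end, is
-- injective on `tagged` but not on all pairs.
unique-map : {f : A → B} {xs : List A} → (∀ {x y} → x ∈ xs → y ∈ xs → f x ≡ f y → x ≡ y) →
             Unique xs → Unique (map f xs)
unique-map inj []         = []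
unique-map inj (x∉ ∷ xs!) =
  All.map⁺ (All.tabulate λ y∈ fx≡fy → All.lookup x∉ y∈ (inj (here refl) (there y∈) fx≡fy))
  ∷ unique-map (λ x∈ y∈ → inj (there x∈) (there y∈)) xs!

-- Repetition-free lists with the same members are equal as bags. This turns a bijection of finite
-- sets into a reindexing of sums by `∑-↭`.
unique-map-↭ : {f : A → B} {xs : List A} {ys : List B} → Unique xs → Unique ys →
               (∀ {x y} → x ∈ xs → y ∈ xs → f x ≡ f y → x ≡ y) →
               (∀ {x} → x ∈ xs → f x ∈ ys) → (∀ {y} → y ∈ ys → y ∈ map f xs) →
               map f xs ↭ ys
unique-map-↭ {f = f} {xs} {ys} xs! ys! inj into onto =
  ∼bag⇒↭ (unique∧set⇒bag (unique-map inj xs!) ys! (mk⇔ to onto))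
  where
  to : ∀ {y} → y ∈ map f xs → y ∈ ys
  to y∈ with x , x∈ , refl ← ∈-map⁻ f y∈ = into x∈

∈-words⁻ : ∀ {xs} (w : Vec ℕ n) → w ∈ words xs n → ∀ i → lookup w i ∈ xs
∈-words⁻ {xs = xs} (x ∷ w) w∈ i
  with _ , _ , x∈ , w∈′ , refl ← ∈-cartesianProductWith⁻ _∷_ xs (words xs _) w∈ | i
... | Fin.zero  = x∈
... | Fin.suc i = ∈-words⁻ w w∈′ i

-- Counting

ind : {P : Set} → Dec P → ℕ
ind P? = if does P? then 1 else 0

count-tabulate : {P : Pred A 0ℓ} (P? : Decidable P) (f : Fin n → A) →
                 count P? (tabulate f) ≡ # (P? ∘ f)
count-tabulate {n = zero}  P? f = refl
count-tabulate {n = suc n} P? f = cong (if does (P? (f Fin.zero)) then suc else id)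
  (trans (count-tabulate P? (f ∘ Fin.suc)) (sym (count-tabulate (P? ∘ f) Fin.suc)))

#-suc : {P : Pred (Fin (suc n)) 0ℓ} (P? : Decidable P) → # P? ≡ ind (P? Fin.zero) + # (P? ∘ Fin.suc)
#-suc P? with does (P? Fin.zero)
... | true  = cong suc (count-tabulate P? Fin.suc)
... | false = count-tabulate P? Fin.suc

ind-yes : {P : Set} (P? : Dec P) → P → ind P? ≡ 1
ind-yes P? p = cong (λ b → if b then 1 else 0) (dec-true P? p)

ind-no : {P : Set} (P? : Dec P) → ¬ P → ind P? ≡ 0
ind-no P? ¬p = cong (λ b → if b then 1 else 0) (dec-false P? ¬p)

-- Makes the library's lemmas on finite sums, such as invariance under permutations and additivity,
-- available for counts.
#-sum : {P : Pred (Fin n) 0ℓ} (P? : Decidable P) → # P? ≡ sum (ind ∘ P?)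
#-sum {zero}  P? = refl
#-sum {suc n} P? = trans (#-suc P?) (cong (λ s → ind (P? Fin.zero) + s) (#-sum (P? ∘ Fin.suc)))

ind-⇔ : {P Q : Set} (P? : Dec P) (Q? : Dec Q) → P ⇔ Q → ind P? ≡ ind Q?
ind-⇔ P? Q? P⇔Q = cong (λ b → if b then 1 else 0) (does-⇔ P⇔Q P? Q?)

#-⇔ : {P Q : Pred (Fin n) 0ℓ} (P? : Decidable P) (Q? : Decidable Q) → (∀ i → P i ⇔ Q i) → # P? ≡ # Q?
#-⇔ P? Q? P⇔Q = trans (#-sum P?) (trans (sum-cong-≗ λ i → ind-⇔ (P? i) (Q? i) (P⇔Q i)) (sym (#-sum Q?)))

#-permute : {P : Pred (Fin n) 0ℓ} (P? : Decidable P) (ρ : Permutation n n) → # (λ i → P? (ρ ⟨$⟩ʳ i)) ≡ # P?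
#-permute P? ρ = trans (#-sum (λ i → P? (ρ ⟨$⟩ʳ i))) (trans (sym (sum-permute (ind ∘ P?) ρ)) (sym (#-sum P?)))

sum-const : ∀ n c → sum {n} (λ _ → c) ≡ n * c
sum-const zero    c = refl
sum-const (suc n) c = cong (λ s → c + s) (sum-const n c)

#-all : {P : Pred (Fin n) 0ℓ} (P? : Decidable P) → (∀ i → P i) → # P? ≡ n
#-all {n} P? p = trans (#-sum P?)
  (trans (sum-cong-≗ λ i → ind-yes (P? i) (p i)) (trans (sum-const n 1) (ℕ.*-identityʳ n)))

#-none : {P : Pred (Fin n) 0ℓ} (P? : Decidable P) → (∀ i → ¬ P i) → # P? ≡ 0
#-none {n} P? p = trans (#-sum P?)
  (trans (sum-cong-≗ λ i → ind-no (P? i) (p i)) (trans (sum-const n 0) (ℕ.*-zeroʳ n)))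

-- A single failing position would leave too few others to reach the count.
#-all⁻ : {P : Pred (Fin n) 0ℓ} (P? : Decidable P) → n ≤ # P? → ∀ i → P i
#-all⁻ {suc n} P? n≤# i with P? Fin.zero | subst (suc n ≤_) (#-suc P?) n≤#
#-all⁻ {suc n} P? n≤# Fin.zero    | yes p | _ = p
#-all⁻ {suc n} P? n≤# (Fin.suc i) | yes p | s≤s n≤#′ = #-all⁻ (P? ∘ Fin.suc) n≤#′ i
#-all⁻ {suc n} P? n≤# i           | no ¬p | 1+n≤# =
  contradiction (ℕ.≤-trans 1+n≤# (count≤n (P? ∘ Fin.suc) (allFin n))) (ℕ.<-irrefl refl)

#-+ : {P Q : Pred (Fin n) 0ℓ} (P? : Decidable P) (Q? : Decidable Q) →
      # P? + # Q? ≡ sum (λ i → ind (P? i) + ind (Q? i))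
#-+ P? Q? = trans (cong₂ _+_ (#-sum P?) (#-sum Q?)) (sym (∑-distrib-+ (ind ∘ P?) (ind ∘ Q?)))

-- Sums of polynomials

-- Polynomial identities are proved coefficient by coefficient throughout, since equal polynomials
-- may be lists that differ in trailing zeros.
coeff-+ₚ : ∀ p r k → coeff (p +ₚ r) k ≡ coeff p k +ᶻ coeff r k
coeff-+ₚ []      r       k       = sym (ℤ.+-identityˡ _)
coeff-+ₚ (a ∷ p) []      k       = sym (ℤ.+-identityʳ _)
coeff-+ₚ (a ∷ p) (b ∷ r) zero    = refl
coeff-+ₚ (a ∷ p) (b ∷ r) (suc k) = coeff-+ₚ p r k

coeff-scale : ∀ a p k → coeff (map (a *ᶻ_) p) k ≡ a *ᶻ coeff p k
coeff-scale a []      k       = sym (ℤ.*-zeroʳ a)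
coeff-scale a (b ∷ p) zero    = refl
coeff-scale a (b ∷ p) (suc k) = coeff-scale a p k

coeff-shift-* : ∀ p r k → coeff ((0ℤ ∷ p) *ₚ r) k ≡ coeff (0ℤ ∷ (p *ₚ r)) k
coeff-shift-* p r k = begin
  coeff (map (0ℤ *ᶻ_) r +ₚ (0ℤ ∷ (p *ₚ r))) k          ≡⟨ coeff-+ₚ (map (0ℤ *ᶻ_) r) _ k ⟩
  coeff (map (0ℤ *ᶻ_) r) k +ᶻ coeff (0ℤ ∷ (p *ₚ r)) k
    ≡⟨ cong (_+ᶻ coeff (0ℤ ∷ (p *ₚ r)) k) (coeff-scale 0ℤ r k) ⟩
  0ℤ *ᶻ coeff r k +ᶻ coeff (0ℤ ∷ (p *ₚ r)) k ≡⟨ ℤ.+-identityˡ _ ⟩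
  coeff (0ℤ ∷ (p *ₚ r)) k                    ∎
  where open ≡-Reasoning

coeff-const-* : ∀ a r k → coeff (const a *ₚ r) k ≡ a *ᶻ coeff r k
coeff-const-* a r k = begin
  coeff (map (a *ᶻ_) r +ₚ (0ℤ ∷ [])) k         ≡⟨ coeff-+ₚ (map (a *ᶻ_) r) _ k ⟩
  coeff (map (a *ᶻ_) r) k +ᶻ coeff (0ℤ ∷ []) k ≡⟨ cong₂ _+ᶻ_ (coeff-scale a r k) (coeff-0 k) ⟩
  a *ᶻ coeff r k +ᶻ 0ℤ                         ≡⟨ ℤ.+-identityʳ _ ⟩
  a *ᶻ coeff r k                               ∎
  where
  open ≡-Reasoning
  coeff-0 : ∀ k → coeff (0ℤ ∷ []) k ≡ 0ℤ
  coeff-0 zero    = refl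
  coeff-0 (suc k) = refl

coeff-∷-cong : ∀ {p r} → p ≈ r → (0ℤ ∷ p) ≈ (0ℤ ∷ r)
coeff-∷-cong p≈r zero    = refl
coeff-∷-cong p≈r (suc k) = p≈r k

1*-≈ : ∀ r → const 1ℤ *ₚ r ≈ r
1*-≈ r k = trans (coeff-const-* 1ℤ r k) (ℤ.*-identityˡ _)

q*-≈ : ∀ r → q *ₚ r ≈ 0ℤ ∷ r
q*-≈ r k = trans (coeff-shift-* (const 1ℤ) r k) (coeff-∷-cong (1*-≈ r) k)

-- Writing the shifted coefficient as that of `0ℤ ∷ r` avoids splitting on whether k is zero.
coeff-linear-* : ∀ a r k → coeff ((q +ₚ const a) *ₚ r) k ≡ a *ᶻ coeff r k +ᶻ coeff (0ℤ ∷ r) k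
coeff-linear-* a r k = begin
  coeff (map ((0ℤ +ᶻ a) *ᶻ_) r +ₚ (0ℤ ∷ (const 1ℤ *ₚ r))) k
    ≡⟨ coeff-+ₚ (map ((0ℤ +ᶻ a) *ᶻ_) r) _ k ⟩
  coeff (map ((0ℤ +ᶻ a) *ᶻ_) r) k +ᶻ coeff (0ℤ ∷ (const 1ℤ *ₚ r)) k
     ≡⟨ cong₂ _+ᶻ_ (trans (coeff-scale (0ℤ +ᶻ a) r k) (cong (_*ᶻ coeff r k) (ℤ.+-identityˡ a)))
                   (coeff-∷-cong (1*-≈ r) k) ⟩
  a *ᶻ coeff r k +ᶻ coeff (0ℤ ∷ r) k ∎
  where open ≡-Reasoning

∑-↭ : ∀ {xs ys : List A} (f : A → Poly) → xs ↭ ys → ∑ xs f ≈ ∑ ys f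
∑-↭ f Perm.refl k = refl
∑-↭ f (Perm.prep {xs} {ys} x xs↭ys) k = begin
  coeff (f x +ₚ ∑ xs f) k           ≡⟨ coeff-+ₚ (f x) _ k ⟩
  coeff (f x) k +ᶻ coeff (∑ xs f) k ≡⟨ cong (coeff (f x) k +ᶻ_) (∑-↭ f xs↭ys k) ⟩
  coeff (f x) k +ᶻ coeff (∑ ys f) k ≡⟨ coeff-+ₚ (f x) _ k ⟨
  coeff (f x +ₚ ∑ ys f) k           ∎
  where open ≡-Reasoning
∑-↭ f (Perm.swap {xs} {ys} x y xs↭ys) k = begin
  coeff (f x +ₚ (f y +ₚ ∑ xs f)) k                       ≡⟨ expand x y xs ⟩
  coeff (f x) k +ᶻ (coeff (f y) k +ᶻ coeff (∑ xs f) k)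
    ≡⟨ cong (λ s → coeff (f x) k +ᶻ (coeff (f y) k +ᶻ s)) (∑-↭ f xs↭ys k) ⟩
  coeff (f x) k +ᶻ (coeff (f y) k +ᶻ coeff (∑ ys f) k)
    ≡⟨ exchange (coeff (f x) k) (coeff (f y) k) _ ⟩
  coeff (f y) k +ᶻ (coeff (f x) k +ᶻ coeff (∑ ys f) k) ≡⟨ expand y x ys ⟨
  coeff (f y +ₚ (f x +ₚ ∑ ys f)) k                     ∎
  where
  open ≡-Reasoning
  exchange : ∀ a b c → a +ᶻ (b +ᶻ c) ≡ b +ᶻ (a +ᶻ c)
  exchange = ℤSolver.solve-∀
  expand : ∀ x y zs → coeff (f x +ₚ (f y +ₚ ∑ zs f)) k ≡ coeff (f x) k +ᶻ (coeff (f y) k +ᶻ coeff (∑ zs f) k)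
  expand x y zs = trans (coeff-+ₚ (f x) _ k) (cong (coeff (f x) k +ᶻ_) (coeff-+ₚ (f y) _ k))
∑-↭ f (Perm.trans xs↭ys ys↭zs) k = trans (∑-↭ f xs↭ys k) (∑-↭ f ys↭zs k)

coeff-∑-++ : ∀ (xs ys : List A) (f : A → Poly) k →
  coeff (∑ (xs ++ ys) f) k ≡ coeff (∑ xs f) k +ᶻ coeff (∑ ys f) k
coeff-∑-++ []       ys f k = sym (ℤ.+-identityˡ _)
coeff-∑-++ (x ∷ xs) ys f k = begin
  coeff (f x +ₚ ∑ (xs ++ ys) f) k                            ≡⟨ coeff-+ₚ (f x) _ k ⟩
  coeff (f x) k +ᶻ coeff (∑ (xs ++ ys) f) k
    ≡⟨ cong (coeff (f x) k +ᶻ_) (coeff-∑-++ xs ys f k) ⟩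
  coeff (f x) k +ᶻ (coeff (∑ xs f) k +ᶻ coeff (∑ ys f) k)  ≡⟨ ℤ.+-assoc (coeff (f x) k) _ _ ⟨
  coeff (f x) k +ᶻ coeff (∑ xs f) k +ᶻ coeff (∑ ys f) k
    ≡⟨ cong (_+ᶻ coeff (∑ ys f) k) (coeff-+ₚ (f x) _ k) ⟨
  coeff (f x +ₚ ∑ xs f) k +ᶻ coeff (∑ ys f) k               ∎
  where open ≡-Reasoning

∑-map : ∀ (g : A → B) xs (f : B → Poly) → ∑ (map g xs) f ≡ ∑ xs (f ∘ g)
∑-map g []       f = refl
∑-map g (x ∷ xs) f = cong (f (g x) +ₚ_) (∑-map g xs f)

∑-cong : ∀ (xs : List A) (f g : A → Poly) → (∀ {x} → x ∈ xs → f x ≈ g x) → ∑ xs f ≈ ∑ xs g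
∑-cong []       f g f≈g k = refl
∑-cong (x ∷ xs) f g f≈g k = begin
  coeff (f x +ₚ ∑ xs f) k            ≡⟨ coeff-+ₚ (f x) _ k ⟩
  coeff (f x) k +ᶻ coeff (∑ xs f) k
    ≡⟨ cong₂ _+ᶻ_ (f≈g (here refl) k) (∑-cong xs f g (f≈g ∘ there) k) ⟩
  coeff (g x) k +ᶻ coeff (∑ xs g) k ≡⟨ coeff-+ₚ (g x) _ k ⟨
  coeff (g x +ₚ ∑ xs g) k           ∎
  where open ≡-Reasoning

coeff-∑-const : ∀ (xs : List A) p k → coeff (∑ xs (λ _ → p)) k ≡ + length xs *ᶻ coeff p k
coeff-∑-const []       p k = sym (ℤ.*-zeroˡ (coeff p k))
coeff-∑-const (x ∷ xs) p k = begin
  coeff (p +ₚ ∑ xs (λ _ → p)) k         ≡⟨ coeff-+ₚ p _ k ⟩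
  coeff p k +ᶻ coeff (∑ xs (λ _ → p)) k ≡⟨ cong (λ s → coeff p k +ᶻ s) (coeff-∑-const xs p k) ⟩
  coeff p k +ᶻ + length xs *ᶻ coeff p k ≡⟨ ℤ.suc-* (+ length xs) (coeff p k) ⟨
  sucᶻ (+ length xs) *ᶻ coeff p k       ≡⟨⟩
  + suc (length xs) *ᶻ coeff p k        ∎
  where open ≡-Reasoning

∑-cartesianProductWith : ∀ {C : Set} (g : A → B → C) xs ys (f : C → Poly) →
  ∑ (cartesianProductWith g xs ys) f ≈ ∑ xs (λ x → ∑ ys (λ y → f (g x y)))
∑-cartesianProductWith g []       ys f k = refl
∑-cartesianProductWith g (x ∷ xs) ys f k = begin
  coeff (∑ (map (g x) ys ++ cartesianProductWith g xs ys) f) k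
    ≡⟨ coeff-∑-++ (map (g x) ys) _ f k ⟩
  coeff (∑ (map (g x) ys) f) k +ᶻ coeff (∑ (cartesianProductWith g xs ys) f) k
    ≡⟨ cong₂ _+ᶻ_ (cong (λ p → coeff p k) (∑-map (g x) ys f)) (∑-cartesianProductWith g xs ys f k) ⟩
  coeff (∑ ys (f ∘ g x)) k +ᶻ coeff (∑ xs (λ x → ∑ ys (f ∘ g x))) k
    ≡⟨ coeff-+ₚ (∑ ys (f ∘ g x)) _ k ⟨
  coeff (∑ ys (f ∘ g x) +ₚ ∑ xs (λ x → ∑ ys (f ∘ g x))) k ∎
  where open ≡-Reasoning

∑-q* : ∀ (xs : List A) f → ∑ xs (λ x → q *ₚ f x) ≈ 0ℤ ∷ ∑ xs f
∑-q* []       f zero    = refl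
∑-q* []       f (suc k) = refl
∑-q* (x ∷ xs) f k = begin
  coeff (q *ₚ f x +ₚ ∑ xs (λ x → q *ₚ f x)) k           ≡⟨ coeff-+ₚ (q *ₚ f x) _ k ⟩
  coeff (q *ₚ f x) k +ᶻ coeff (∑ xs (λ x → q *ₚ f x)) k ≡⟨ cong₂ _+ᶻ_ (q*-≈ (f x) k) (∑-q* xs f k) ⟩
  coeff (0ℤ ∷ f x) k +ᶻ coeff (0ℤ ∷ ∑ xs f) k           ≡⟨ coeff-+ₚ (0ℤ ∷ f x) (0ℤ ∷ ∑ xs f) k ⟨
  coeff (0ℤ ∷ (f x +ₚ ∑ xs f)) k                        ∎
  where open ≡-Reasoning

-- Serves to sum over the first letter of a word: one letter hits the target of that position, and
-- all others miss it in the same way.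
coeff-∑-exceptional : ∀ {xs : List A} {a} (f : A → Poly) p r → Unique xs → a ∈ xs →
  f a ≈ p → (∀ {x} → x ∈ xs → x ≢ a → f x ≈ r) →
  ∀ k → coeff (∑ xs f) k ≡ coeff p k +ᶻ (+ length xs - 1ℤ) *ᶻ coeff r k
coeff-∑-exceptional {xs = x ∷ xs} f p r (x∉ ∷ _) (here refl) fa fx k = begin
  coeff (f x +ₚ ∑ xs f) k               ≡⟨ coeff-+ₚ (f x) _ k ⟩
  coeff (f x) k +ᶻ coeff (∑ xs f) k
    ≡⟨ cong₂ _+ᶻ_ (fa k) (∑-cong xs f (λ _ → r) (λ y∈ → fx (there y∈) (All.lookup x∉ y∈ ∘ sym)) k) ⟩
  coeff p k +ᶻ coeff (∑ xs (λ _ → r)) k              ≡⟨ cong (coeff p k +ᶻ_) (coeff-∑-const xs r k) ⟩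
  coeff p k +ᶻ + length xs *ᶻ coeff r k              ≡⟨ regroup (coeff r k) (coeff p k) (+ length xs) ⟩
  coeff p k +ᶻ (+ suc (length xs) - 1ℤ) *ᶻ coeff r k ∎
  where
  open ≡-Reasoning
  regroup : ∀ r p l → p +ᶻ l *ᶻ r ≡ p +ᶻ (1ℤ +ᶻ l - 1ℤ) *ᶻ r
  regroup = ℤSolver.solve-∀
coeff-∑-exceptional {xs = x ∷ xs} f p r (x∉ ∷ xs!) (there a∈) fa fx k = begin
  coeff (f x +ₚ ∑ xs f) k           ≡⟨ coeff-+ₚ (f x) _ k ⟩
  coeff (f x) k +ᶻ coeff (∑ xs f) k
    ≡⟨ cong₂ _+ᶻ_ (fx (here refl) (All.lookup x∉ a∈) k) (coeff-∑-exceptional f p r xs! a∈ fa (fx ∘ there) k) ⟩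
  coeff r k +ᶻ (coeff p k +ᶻ (+ length xs - 1ℤ) *ᶻ coeff r k)
    ≡⟨ regroup (coeff r k) (coeff p k) (+ length xs) ⟩
  coeff p k +ᶻ (+ suc (length xs) - 1ℤ) *ᶻ coeff r k ∎
  where
  open ≡-Reasoning
  regroup : ∀ r p l → r +ᶻ (p +ᶻ (l - 1ℤ) *ᶻ r) ≡ p +ᶻ (1ℤ +ᶻ l - 1ℤ) *ᶻ r
  regroup = ℤSolver.solve-∀

-- The sum over all words

^-≡ : {d e : ℕ} → d ≡ e → q ^ d ≈ q ^ e
^-≡ refl k = refl

-- `fix` is the case where g i is the 1-based index of i. A general target g is needed because
-- induction on the length passes to `g ∘ Fin.suc`.
agree : (Fin n → ℕ) → Vec ℕ n → ℕ
agree g w = # (λ i → lookup w i ℕ.≟ g i)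

∑-agree-∷ : ∀ xs (g : Fin (suc n) → ℕ) → ∑ (words xs (suc n)) (λ w → q ^ agree g w) ≈
  ∑ xs (λ x → ∑ (words xs n) (λ w → q ^ (ind (x ℕ.≟ g Fin.zero) + agree (g ∘ Fin.suc) w)))
∑-agree-∷ {n} xs g k = trans (∑-cartesianProductWith _∷_ xs (words xs n) (λ w → q ^ agree g w) k)
  (∑-cong xs _ _ (λ {x} _ → ∑-cong (words xs n) (λ w → q ^ agree g (x ∷ w)) _ λ {w} _ →
    ^-≡ (#-suc (λ i → lookup (x ∷ w) i ℕ.≟ g i))) k)

-- The sum factors over positions. With l letters, a position whose target is a letter contributes q
-- + (l - 1), and the last position, whose target is not a letter, contributes l.
∑-agree : ∀ {xs} → Unique xs → (g : Fin (suc n) → ℕ) → (∀ i → g (inject₁ i) ∈ xs) → g (fromℕ n) ∉ xs →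
  ∀ k → coeff (∑ (words xs (suc n)) (λ w → q ^ agree g w)) k ≡
        + length xs *ᶻ coeff ((q +ₚ const (+ length xs - 1ℤ)) ^ n) k
∑-agree {zero} {xs} xs! g g∈ g∉ k = begin
  coeff (∑ (words xs 1) (λ w → q ^ agree g w)) k ≡⟨ ∑-agree-∷ xs g k ⟩
  coeff (∑ xs (λ x → ∑ ([] ∷ []) (λ w → q ^ (ind (x ℕ.≟ g Fin.zero) + agree (g ∘ Fin.suc) w)))) k
    -- Only the last position is left; no letter agrees with its target, so every summand is q to
    -- the power 0.
    ≡⟨ ∑-cong xs _ (λ _ → const 1ℤ) (λ {x} x∈ → ∑-cong ([] ∷ [])
         (λ w → q ^ (ind (x ℕ.≟ g Fin.zero) + agree (g ∘ Fin.suc) w)) (λ _ → const 1ℤ) λ { (here refl) →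
         ^-≡ (cong (_+ 0) (ind-no (x ℕ.≟ g Fin.zero) λ { refl → g∉ x∈ })) }) k ⟩
  coeff (∑ xs (λ x → const 1ℤ)) k   ≡⟨ coeff-∑-const xs (const 1ℤ) k ⟩
  + length xs *ᶻ coeff (const 1ℤ) k ∎
  where open ≡-Reasoning
∑-agree {suc n} {xs} xs! g g∈ g∉ k = begin
  coeff (∑ (words xs (suc (suc n))) (λ w → q ^ agree g w)) k ≡⟨ ∑-agree-∷ xs g k ⟩
  coeff (∑ xs f) k
    -- The letter `g Fin.zero` yields a factor q, each of the other l - 1 letters a factor 1.
    ≡⟨ coeff-∑-exceptional f (∑ ws (λ w → q *ₚ q ^ h w)) S xs! (g∈ Fin.zero)
         (∑-cong ws _ (λ w → q *ₚ q ^ h w) λ {w} _ → ^-≡ (cong (_+ h w) (ind-yes (g Fin.zero ℕ.≟ g Fin.zero) refl)))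
         (λ {x} _ x≢ → ∑-cong ws _ (λ w → q ^ h w) λ {w} _ → ^-≡ (cong (_+ h w) (ind-no (x ℕ.≟ g Fin.zero) x≢))) k ⟩
  coeff (∑ ws (λ w → q *ₚ q ^ h w)) k +ᶻ a *ᶻ coeff S k
    ≡⟨ cong₂ _+ᶻ_ (∑-q* ws (λ w → q ^ h w) k) (cong (a *ᶻ_) (IH k)) ⟩
  coeff (0ℤ ∷ S) k +ᶻ a *ᶻ (l *ᶻ coeff p k)      ≡⟨ cong (_+ᶻ a *ᶻ (l *ᶻ coeff p k)) (shift k) ⟩
  l *ᶻ coeff (0ℤ ∷ p) k +ᶻ a *ᶻ (l *ᶻ coeff p k) ≡⟨ regroup l (coeff (0ℤ ∷ p) k) a (coeff p k) ⟩
  l *ᶻ (a *ᶻ coeff p k +ᶻ coeff (0ℤ ∷ p) k)      ≡⟨ cong (l *ᶻ_) (coeff-linear-* a p k) ⟨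
  l *ᶻ coeff ((q +ₚ const a) *ₚ p) k             ∎
  where
  open ≡-Reasoning
  ws = words xs (suc n)
  h  = agree (g ∘ Fin.suc)
  f = λ x → ∑ ws (λ w → q ^ (ind (x ℕ.≟ g Fin.zero) + h w))
  S  = ∑ ws (λ w → q ^ h w)
  l  = + length xs
  a  = l - 1ℤ
  p  = (q +ₚ const a) ^ n
  IH : ∀ k → coeff S k ≡ l *ᶻ coeff p k
  IH = ∑-agree xs! (g ∘ Fin.suc) (g∈ ∘ Fin.suc) g∉
  shift : ∀ k → coeff (0ℤ ∷ S) k ≡ l *ᶻ coeff (0ℤ ∷ p) k
  shift zero    = sym (ℤ.*-zeroʳ l)
  shift (suc k) = IH k
  regroup : ∀ l s a p → l *ᶻ s +ᶻ a *ᶻ (l *ᶻ p) ≡ l *ᶻ (a *ᶻ p +ᶻ s)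
  regroup = ℤSolver.solve-∀

-- Prime parking functions by counts

atMost : Vec ℕ n → ℕ → ℕ
atMost w j = # (λ i → lookup w i ≤? j)

-- Passes from positions to the list of entries, where the count is visibly invariant under sorting.
atMost-toList : (w : Vec ℕ n) (j : ℕ) → atMost w j ≡ length (filter (_≤? j) (toList w))
atMost-toList []      j = refl
atMost-toList (x ∷ w) j = trans (#-suc (λ i → lookup (x ∷ w) i ≤? j))
  (trans (cong (λ s → ind (x ≤? j) + s) (atMost-toList w j)) step)
  where
  step : ind (x ≤? j) + length (filter (_≤? j) (toList w)) ≡ length (filter (_≤? j) (x ∷ toList w))
  step with does (x ≤? j)
  ... | true  = refl
  ... | false = refl

-- In a sorted list the entries at most v form an initial segment, so position i lies in it as soon
-- as the segment has more than i entries.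
sorted-lookup-≤ : ∀ {xs} v → AllPairs _≤_ xs → (i : Fin (length xs)) →
                  suc (toℕ i) ≤ length (filter (_≤? v) xs) → List.lookup xs i ≤ v
sorted-lookup-≤ {x ∷ xs} v (x≤ ∷ xs↗) i i< with x ≤? v
sorted-lookup-≤ {x ∷ xs} v (x≤ ∷ xs↗) Fin.zero    i< | yes x≤v = x≤v
sorted-lookup-≤ {x ∷ xs} v (x≤ ∷ xs↗) (Fin.suc i) i< | yes x≤v =
  sorted-lookup-≤ v xs↗ i (s≤s⁻¹ (subst (λ ys → _ ≤ length ys) (filter-accept (_≤? v) {xs = xs} x≤v) i<))
sorted-lookup-≤ {x ∷ xs} v (x≤ ∷ xs↗) i           i< | no x≰v
  with () ← subst (λ ys → _ ≤ length ys)
    (filter-none (_≤? v) {xs = x ∷ xs} (x≰v ∷ All.map (λ x≤y y≤v → x≰v (ℕ.≤-trans x≤y y≤v)) x≤)) i<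

PrimeCounts : ∀ {m} → Vec ℕ (suc m) → Set
PrimeCounts {m} w = ∀ j → 1 ≤ j → j ≤ m → suc j ≤ atMost w j

Letters : ℕ → Vec ℕ n → Set
Letters m w = ∀ i → 1 ≤ lookup w i × lookup w i ≤ m

module _ {m : ℕ} (1≤m : 1 ≤ m) where

  -- The prime counts already force the parking condition: at each of the first m sorted positions,
  -- the count for j equal to its 1-based index suffices.
  isPrimeParking⁺ : (w : Vec ℕ (suc m)) → (∀ i → 1 ≤ lookup w i) → PrimeCounts w → IsPrimeParking w
  isPrimeParking⁺ w pos counts = (pos , λ≤) , counts
    where
    ƛ = sort (toList w)

    counts-ƛ : ∀ j → 1 ≤ j → j ≤ m → suc j ≤ length (filter (_≤? j) ƛ)
    counts-ƛ j 1≤j j≤m = ℕ.≤-trans (counts j 1≤j j≤m)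
      (ℕ.≤-reflexive (trans (atMost-toList w j) (↭-length (filter-↭ (_≤? j) (↭-sym (sort-↭ (toList w)))))))

    length-ƛ : length ƛ ≡ suc m
    length-ƛ = trans (↭-length (sort-↭ (toList w))) (length-toList w)

    λ≤ : ∀ i → List.lookup ƛ i ≤ suc (toℕ i)
    λ≤ i with suc (toℕ i) ≤? m
    ... | yes i<m = sorted-lookup-≤ _ (Linked⇒AllPairs ℕ.≤-trans (sort-↗ (toList w))) i
                      (ℕ.<⇒≤ (counts-ƛ _ (s≤s z≤n) i<m))
    -- At the last position j would be m + 1, out of range; the count for j = m covers all m + 1
    -- entries and gives the stronger bound m.
    ... | no  i≮m = ℕ.≤-trans
                      (sorted-lookup-≤ m (Linked⇒AllPairs ℕ.≤-trans (sort-↗ (toList w))) i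
                        (ℕ.≤-trans (subst (suc (toℕ i) ≤_) length-ƛ (toℕ<n i)) (counts-ƛ m 1≤m ℕ.≤-refl)))
                      (ℕ.<⇒≤ (ℕ.≰⇒> i≮m))

  -- For j = m the prime condition counts m + 1 positions, which is all of them.
  isPrimeParking⇒Letters : (w : Vec ℕ (suc m)) → IsPrimeParking w → Letters m w
  isPrimeParking⇒Letters w ((pos , _) , counts) i =
    pos i , #-all⁻ (λ i → lookup w i ≤? m) (counts m 1≤m ℕ.≤-refl) i

-- The cycle lemma

-- t is the last point of [0, m] at which F u − u is minimal; both sides are
-- moved so that no subtraction occurs.
Good : (ℕ → ℕ) → ℕ → ℕ → Set
Good F m t = (∀ u → t < u → u ≤ m → F t + u < F u + t) × (∀ u → u ≤ t → F t + u ≤ F u + t)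

-- The strict inequality after t contradicts the weak inequality before t′.
Good-≮ : ∀ {F m t t′} → Good F m t → Good F m t′ → t′ ≤ m → ¬ t < t′
Good-≮ (later , _) (_ , earlier) t′≤m t<t′ =
  ℕ.<⇒≱ (later _ t<t′ t′≤m) (earlier _ (ℕ.<⇒≤ t<t′))

Good-unique : ∀ {F m t t′} → t ≤ m → t′ ≤ m → Good F m t → Good F m t′ → t ≡ t′
Good-unique t≤m t′≤m gt gt′ = ℕ.≤-antisym (ℕ.≮⇒≥ (Good-≮ gt′ gt t≤m)) (ℕ.≮⇒≥ (Good-≮ gt gt′ t′≤m))

last-argmin : ∀ F m → ∃[ t ] t ≤ m × Good F m t
last-argmin F zero = 0 , z≤n , (λ { (suc u) _ () }) , (λ { zero _ → ℕ.≤-refl })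
last-argmin F (suc m) with last-argmin F m
-- The new point m + 1 takes over unless it is strictly worse; letting it win ties keeps the minimum
-- the last one.
... | t , t≤m , later , earlier with F t + suc m <? F (suc m) + t
...   | yes Ft<Fs = t , ℕ.m≤n⇒m≤1+n t≤m , later′ , earlier
  where
  later′ : ∀ u → t < u → u ≤ suc m → F t + u < F u + t
  later′ u t<u u≤1+m with ℕ.m≤n⇒m<n∨m≡n u≤1+m
  ... | inj₁ u<1+m = later u t<u (s≤s⁻¹ u<1+m)
  ... | inj₂ refl  = Ft<Fs
...   | no  Ft≮Fs = suc m , ℕ.≤-refl , (λ u m<u u≤m → contradiction u≤m (ℕ.<⇒≱ m<u)) , earlier′
  where
  weak : ∀ u → u ≤ m → F t + u ≤ F u + t
  weak u u≤m with ℕ.<-≤-connex t u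
  ... | inj₁ t<u = ℕ.<⇒≤ (later u t<u u≤m)
  ... | inj₂ u≤t = earlier u u≤t
  earlier′ : ∀ u → u ≤ suc m → F (suc m) + u ≤ F u + suc m
  earlier′ u u≤1+m with ℕ.m≤n⇒m<n∨m≡n u≤1+m
  ... | inj₂ refl  = ℕ.≤-refl
  -- Chains F (m+1) - (m+1) ≤ F t - t ≤ F u - u; the added t replaces the subtractions.
  ... | inj₁ u<1+m = ℕ.+-cancelʳ-≤ t _ _ (begin
    F (suc m) + u + t ≡⟨ swap₂₃ (F (suc m)) u t ⟩
    F (suc m) + t + u ≤⟨ ℕ.+-monoˡ-≤ u (ℕ.≮⇒≥ Ft≮Fs) ⟩
    F t + suc m + u   ≡⟨ swap₂₃ (F t) (suc m) u ⟩
    F t + u + suc m   ≤⟨ ℕ.+-monoˡ-≤ (suc m) (weak u (s≤s⁻¹ u<1+m)) ⟩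
    F u + t + suc m   ≡⟨ swap₂₃ (F u) t (suc m) ⟩
    F u + suc m + t   ∎)
    where
    open ℕ.≤-Reasoning
    swap₂₃ : ∀ a b c → a + b + c ≡ a + c + b
    swap₂₃ = ℕSolver.solve-∀

-- Rotations

-- Letters and positions are 0-based here: x ↦ x − t modulo m below m, and the
-- identity from m on, which is what fixes the last position.  Opaque because
-- unification would otherwise unfold the nested conditionals.
opaque
  rotate : ℕ → ℕ → ℕ → ℕ
  rotate m t x = if does (x <? t) then x + (m ∸ t) else if does (x <? m) then x ∸ t else x

  rotate-< : ∀ m t x → x < t → rotate m t x ≡ x + (m ∸ t)
  rotate-< m t x x<t rewrite dec-true (x <? t) x<t = refl

  rotate-≥ : ∀ m t x → t ≤ x → x < m → rotate m t x ≡ x ∸ t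
  rotate-≥ m t x t≤x x<m rewrite dec-false (x <? t) (ℕ.≤⇒≯ t≤x) | dec-true (x <? m) x<m = refl

  rotate-fixed : ∀ m t x → t ≤ x → m ≤ x → rotate m t x ≡ x
  rotate-fixed m t x t≤x m≤x
    rewrite dec-false (x <? t) (ℕ.≤⇒≯ t≤x) | dec-false (x <? m) (ℕ.≤⇒≯ m≤x) = refl

rotate-<m : ∀ {m t x} → t ≤ m → x < m → rotate m t x < m
rotate-<m {m} {t} {x} t≤m x<m with ℕ.<-≤-connex x t
... | inj₁ x<t = subst₂ _<_ (sym (rotate-< m t x x<t)) (ℕ.m+[n∸m]≡n t≤m) (ℕ.+-monoˡ-< (m ∸ t) x<t)
... | inj₂ t≤x = subst (_< m) (sym (rotate-≥ m t x t≤x x<m)) (ℕ.≤-<-trans (ℕ.m∸n≤m x t) x<m)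

module _ {m t t′ : ℕ} (t+t′≡m : t + t′ ≡ m) where

  t≤m : t ≤ m
  t≤m = subst (t ≤_) t+t′≡m (ℕ.m≤m+n t t′)

  m∸t≡t′ : m ∸ t ≡ t′
  m∸t≡t′ = trans (cong (_∸ t) (sym t+t′≡m)) (ℕ.m+n∸m≡n t t′)

rotate-<′ : ∀ {m t t′ x} → t + t′ ≡ m → x < t → rotate m t x ≡ x + t′
rotate-<′ {m} {t} {t′} {x} t+t′≡m x<t = trans (rotate-< m t x x<t) (cong (λ d → x + d) (m∸t≡t′ t+t′≡m))

-- Rotation by t moves [0, t) onto [t′, m) and [t, m) onto [0, t′), so rotation by t′ takes the
-- opposite branch. Points from m on are fixed by both.
rotate-inverse : ∀ {m t t′} → t + t′ ≡ m → ∀ x → rotate m t′ (rotate m t x) ≡ x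
rotate-inverse {m} {t} {t′} t+t′≡m x with ℕ.<-≤-connex x t
... | inj₁ x<t = trans (cong (rotate m t′) (rotate-<′ t+t′≡m x<t))
  (trans (rotate-≥ m t′ (x + t′) (ℕ.m≤n+m t′ x) (subst (x + t′ <_) t+t′≡m (ℕ.+-monoˡ-< t′ x<t)))
         (ℕ.m+n∸n≡m x t′))
... | inj₂ t≤x with ℕ.<-≤-connex x m
...   | inj₁ x<m = trans (cong (rotate m t′) (rotate-≥ m t x t≤x x<m))
  (trans (rotate-<′ (trans (ℕ.+-comm t′ t) t+t′≡m) (subst (x ∸ t <_) (m∸t≡t′ t+t′≡m) (ℕ.∸-monoˡ-< x<m t≤x)))
         (ℕ.m∸n+n≡m t≤x))
...   | inj₂ m≤x = trans (cong (rotate m t′) (rotate-fixed m t x t≤x m≤x))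
  (rotate-fixed m t′ x (ℕ.≤-trans (t≤m (trans (ℕ.+-comm t′ t) t+t′≡m)) m≤x) m≤x)

-- Holds for every t, which lets `rotateFin` take a bare number: if x < t, then x + (m ∸ t) ≤ x + (m
-- ∸ x) = m.
rotate-bound : ∀ m t x → x < suc m → rotate m t x < suc m
rotate-bound m t x x≤m with ℕ.<-≤-connex x t
... | inj₁ x<t = s≤s (subst₂ _≤_ (sym (rotate-< m t x x<t)) (ℕ.m+[n∸m]≡n (s≤s⁻¹ x≤m))
  (ℕ.+-monoʳ-≤ x (ℕ.∸-monoʳ-≤ m (ℕ.<⇒≤ x<t))))
... | inj₂ t≤x with ℕ.<-≤-connex x m
...   | inj₁ x<m = subst (_< suc m) (sym (rotate-≥ m t x t≤x x<m)) (ℕ.≤-<-trans (ℕ.m∸n≤m x t) x≤m)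
...   | inj₂ m≤x = subst (_< suc m) (sym (rotate-fixed m t x t≤x m≤x)) x≤m

rotateFin : ∀ {m} → ℕ → Fin (suc m) → Fin (suc m)
rotateFin {m} t i = fromℕ< (rotate-bound m t (toℕ i) (toℕ<n i))

toℕ-rotateFin : ∀ {m} t (i : Fin (suc m)) → toℕ (rotateFin t i) ≡ rotate m t (toℕ i)
toℕ-rotateFin t i = toℕ-fromℕ< _

rotateFin-inverse : ∀ {m t t′} → t + t′ ≡ m → (i : Fin (suc m)) → rotateFin t′ (rotateFin t i) ≡ i
rotateFin-inverse {m} {t} {t′} eq i = toℕ-injective
  (trans (toℕ-rotateFin t′ (rotateFin t i))
    (trans (cong (rotate m t′) (toℕ-rotateFin t i)) (rotate-inverse eq (toℕ i))))

-- t′ is meant to be m − t, which makes rotateFin t′ the inverse of the rotation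
-- of positions by t.
rotateWord : ∀ {m} → ℕ → ℕ → Vec ℕ (suc m) → Vec ℕ (suc m)
rotateWord {m} t t′ w = tabulate λ i → suc (rotate m t (pred (lookup w (rotateFin t′ i))))

suc-pred : ∀ {x} → 1 ≤ x → suc (pred x) ≡ x
suc-pred (s≤s _) = refl

module _ {m t t′ : ℕ} (t+t′≡m : t + t′ ≡ m) (w : Vec ℕ (suc m)) where

  private
    t′+t≡m : t′ + t ≡ m
    t′+t≡m = trans (ℕ.+-comm t′ t) t+t′≡m

  lookup-rotateWord : ∀ i → lookup (rotateWord t t′ w) i ≡ suc (rotate m t (pred (lookup w (rotateFin t′ i))))
  lookup-rotateWord = lookup∘tabulate _

  -- The rotations of letters and of positions cancel separately; positivity makes `pred`
  -- reversible.
  rotateWord-inverse : (∀ i → 1 ≤ lookup w i) → rotateWord t′ t (rotateWord t t′ w) ≡ w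
  rotateWord-inverse pos = trans (tabulate-cong pointwise) (tabulate∘lookup w)
    where
    open ≡-Reasoning
    pointwise : ∀ i → suc (rotate m t′ (pred (lookup (rotateWord t t′ w) (rotateFin t i)))) ≡ lookup w i
    pointwise i = begin
      suc (rotate m t′ (pred (lookup (rotateWord t t′ w) (rotateFin t i))))
        ≡⟨ cong (λ x → suc (rotate m t′ (pred x))) (lookup-rotateWord (rotateFin t i)) ⟩
      suc (rotate m t′ (rotate m t (pred (lookup w (rotateFin t′ (rotateFin t i))))))
        ≡⟨ cong suc (rotate-inverse t+t′≡m _) ⟩
      suc (pred (lookup w (rotateFin t′ (rotateFin t i))))
        ≡⟨ cong (λ i → suc (pred (lookup w i))) (rotateFin-inverse t+t′≡m i) ⟩
      suc (pred (lookup w i))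
        ≡⟨ suc-pred (pos i) ⟩
      lookup w i ∎

  private
    -- Sends i to the position from which the rotated word takes its letter at i.
    ρ : Permutation (suc m) (suc m)
    ρ = Permutation.permutation (rotateFin t′) (rotateFin t)
      (rotateFin-inverse t+t′≡m) (rotateFin-inverse t′+t≡m)

  -- Letters and positions turn by the same amount, so i is fixed in the rotated word exactly when ρ
  -- i is fixed in w.
  fix-rotateWord : (∀ i → 1 ≤ lookup w i) → fix (rotateWord t t′ w) ≡ fix w
  fix-rotateWord pos = trans
    (#-⇔ (λ i → lookup (rotateWord t t′ w) i ℕ.≟ suc (toℕ i))
      (λ i → lookup w (ρ ⟨$⟩ʳ i) ℕ.≟ suc (toℕ (ρ ⟨$⟩ʳ i))) λ i → mk⇔ (to i) (from i))
    (#-permute (λ i → lookup w i ℕ.≟ suc (toℕ i)) ρ)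
    where
    open ≡-Reasoning
    to : ∀ i → lookup (rotateWord t t′ w) i ≡ suc (toℕ i) →
         lookup w (rotateFin t′ i) ≡ suc (toℕ (rotateFin t′ i))
    to i eq = begin
      x            ≡⟨ suc-pred (pos (rotateFin t′ i)) ⟨
      suc (pred x) ≡⟨ cong suc (rotate-inverse t+t′≡m (pred x)) ⟨
      suc (rotate m t′ (rotate m t (pred x)))
        ≡⟨ cong (λ y → suc (rotate m t′ (pred y))) (lookup-rotateWord i) ⟨
      suc (rotate m t′ (pred (lookup (rotateWord t t′ w) i)))
        ≡⟨ cong (λ y → suc (rotate m t′ (pred y))) eq ⟩
      suc (rotate m t′ (toℕ i))  ≡⟨ cong suc (toℕ-rotateFin t′ i) ⟨
      suc (toℕ (rotateFin t′ i)) ∎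
      where x = lookup w (rotateFin t′ i)
    from : ∀ i → lookup w (rotateFin t′ i) ≡ suc (toℕ (rotateFin t′ i)) →
           lookup (rotateWord t t′ w) i ≡ suc (toℕ i)
    from i eq = begin
      lookup (rotateWord t t′ w) i                     ≡⟨ lookup-rotateWord i ⟩
      suc (rotate m t (pred (lookup w (rotateFin t′ i))))
        ≡⟨ cong (λ y → suc (rotate m t (pred y))) eq ⟩
      suc (rotate m t (toℕ (rotateFin t′ i)))
        ≡⟨ cong (λ y → suc (rotate m t y)) (toℕ-rotateFin t′ i) ⟩
      suc (rotate m t (rotate m t′ (toℕ i))) ≡⟨ cong suc (rotate-inverse t′+t≡m (toℕ i)) ⟩
      suc (toℕ i)                            ∎

  -- Counting is blind to the order of positions, so only the rotation of the letters matters here.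
  atMost-rotateWord : ∀ j → atMost (rotateWord t t′ w) j ≡ # (λ i → suc (rotate m t (pred (lookup w i))) ≤? j)
  atMost-rotateWord j = trans
    (#-⇔ (λ i → lookup (rotateWord t t′ w) i ≤? j) (λ i → suc (rotate m t (pred (lookup w (ρ ⟨$⟩ʳ i)))) ≤? j)
      λ i → mk⇔ (subst (_≤ j) (lookup-rotateWord i)) (subst (_≤ j) (sym (lookup-rotateWord i))))
    (#-permute (λ i → suc (rotate m t (pred (lookup w i))) ≤? j) ρ)

-- Counts of a rotated word

letter-pred : ∀ {m} (w : Vec ℕ n) → Letters m w → ∀ i → suc (pred (lookup w i)) ≡ lookup w i
letter-pred w lw i = suc-pred (proj₁ (lw i))

pred-letter-< : ∀ {m} (w : Vec ℕ n) → Letters m w → ∀ i → pred (lookup w i) < m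
pred-letter-< {m = m} w lw i = subst (_≤ m) (sym (letter-pred w lw i)) (proj₂ (lw i))

module _ {m t t′ : ℕ} (t+t′≡m : t + t′ ≡ m) where

  -- The letters sent to 1, ..., j are those in (t, j + t], an interval that does not pass m.
  ind-unwrapped : ∀ {x j} → x < m → j + t ≤ m →
    ind (suc (rotate m t x) ≤? j) + ind (suc x ≤? t) ≡ ind (suc x ≤? j + t)
  ind-unwrapped {x} {j} x<m j+t≤m with ℕ.<-≤-connex x t
  ... | inj₁ x<t rewrite rotate-<′ t+t′≡m x<t = begin
    ind (suc (x + t′) ≤? j) + ind (suc x ≤? t)
      ≡⟨ cong₂ _+_ (ind-no (suc (x + t′) ≤? j) j≯) (ind-yes (suc x ≤? t) x<t) ⟩
    1
      ≡⟨ ind-yes (suc x ≤? j + t) (ℕ.≤-trans x<t (ℕ.m≤n+m t j)) ⟨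
    ind (suc x ≤? j + t)                       ∎
    where
    open ≡-Reasoning
    j≤t′ : j ≤ t′
    j≤t′ = ℕ.+-cancelʳ-≤ t j t′ (subst (j + t ≤_) (trans (sym t+t′≡m) (ℕ.+-comm t t′)) j+t≤m)
    j≯ : ¬ x + t′ < j
    j≯ = ℕ.≤⇒≯ (ℕ.≤-trans j≤t′ (ℕ.m≤n+m t′ x))
  ... | inj₂ t≤x rewrite rotate-≥ m t x t≤x x<m = begin
    ind (suc (x ∸ t) ≤? j) + ind (suc x ≤? t)
      ≡⟨ cong₂ _+_ (ind-⇔ (suc (x ∸ t) ≤? j) (suc x ≤? j + t) (mk⇔ to from)) (ind-no (suc x ≤? t) (ℕ.≤⇒≯ t≤x)) ⟩
    ind (suc x ≤? j + t) + 0 ≡⟨ ℕ.+-identityʳ _ ⟩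
    ind (suc x ≤? j + t)     ∎
    where
    open ≡-Reasoning
    to : x ∸ t < j → x < j + t
    to lt = subst (_< j + t) (ℕ.m∸n+n≡m t≤x) (ℕ.+-monoˡ-< t lt)
    from : x < j + t → x ∸ t < j
    from lt = ℕ.+-cancelʳ-< t _ _ (subst (_< j + t) (sym (ℕ.m∸n+n≡m t≤x)) lt)

  -- Here the interval passes m: the letters sent to 1, ..., j are those in (t, m] and in [1, u].
  ind-wrapped : ∀ {x j u} → x < m → u ≤ t → j + t ≡ m + u →
    ind (suc (rotate m t x) ≤? j) + ind (suc x ≤? t) ≡ ind (suc x ≤? u) + 1
  ind-wrapped {x} {j} {u} x<m u≤t j+t≡m+u with ℕ.<-≤-connex x t
  ... | inj₁ x<t rewrite rotate-<′ t+t′≡m x<t =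
    cong₂ _+_ (ind-⇔ (suc (x + t′) ≤? j) (suc x ≤? u) (mk⇔ to from)) (ind-yes (suc x ≤? t) x<t)
    where
    j≡u+t′ : j ≡ u + t′
    j≡u+t′ = ℕ.+-cancelʳ-≡ t j (u + t′) (trans j+t≡m+u (trans (cong (_+ u) (sym t+t′≡m)) (rearrange t t′ u)))
      where
      rearrange : ∀ a b c → a + b + c ≡ c + b + a
      rearrange = ℕSolver.solve-∀
    to : x + t′ < j → x < u
    to lt = ℕ.+-cancelʳ-< t′ _ _ (subst (x + t′ <_) j≡u+t′ lt)
    from : x < u → x + t′ < j
    from lt = subst (x + t′ <_) (sym j≡u+t′) (ℕ.+-monoˡ-< t′ lt)
  ... | inj₂ t≤x rewrite rotate-≥ m t x t≤x x<m = begin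
    ind (suc (x ∸ t) ≤? j) + ind (suc x ≤? t)
      ≡⟨ cong₂ _+_ (ind-yes (suc (x ∸ t) ≤? j) lt) (ind-no (suc x ≤? t) (ℕ.≤⇒≯ t≤x)) ⟩
    1
      ≡⟨ cong (_+ 1) (ind-no (suc x ≤? u) (ℕ.≤⇒≯ (ℕ.≤-trans u≤t t≤x))) ⟨
    ind (suc x ≤? u) + 1                      ∎
    where
    open ≡-Reasoning
    lt : x ∸ t < j
    lt = ℕ.+-cancelʳ-< t _ _ (subst₂ _<_ (sym (ℕ.m∸n+n≡m t≤x)) (sym j+t≡m+u) (ℕ.<-≤-trans x<m (ℕ.m≤m+n m u)))

  module _ (w : Vec ℕ (suc m)) (letters : Letters m w) where

    open ≡-Reasoning

    private
      rotated : ℕ → Fin (suc m) → ℕ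
      rotated j i = ind (suc (rotate m t (pred (lookup w i))) ≤? j)

      lhs : ∀ j → atMost (rotateWord t t′ w) j + atMost w t ≡
                  sum (λ i → rotated j i + ind (suc (pred (lookup w i)) ≤? t))
      lhs j = trans (cong (_+ atMost w t) (atMost-rotateWord t+t′≡m w j))
        (trans (#-+ (λ i → suc (rotate m t (pred (lookup w i))) ≤? j) (λ i → lookup w i ≤? t))
               (sum-cong-≗ λ i → cong (λ y → rotated j i + ind (y ≤? t)) (sym (letter-pred w letters i))))

    atMost-unwrapped : ∀ j → j + t ≤ m → atMost (rotateWord t t′ w) j + atMost w t ≡ atMost w (j + t)
    atMost-unwrapped j j+t≤m = begin
      atMost (rotateWord t t′ w) j + atMost w t ≡⟨ lhs j ⟩
      sum (λ i → rotated j i + ind (suc (pred (lookup w i)) ≤? t))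
        ≡⟨ sum-cong-≗ (λ i → ind-unwrapped (pred-letter-< w letters i) j+t≤m) ⟩
      sum (λ i → ind (suc (pred (lookup w i)) ≤? j + t))
        ≡⟨ sum-cong-≗ (λ i → cong (λ y → ind (y ≤? j + t)) (letter-pred w letters i)) ⟩
      sum (λ i → ind (lookup w i ≤? j + t)) ≡⟨ #-sum (λ i → lookup w i ≤? j + t) ⟨
      atMost w (j + t)                      ∎

    -- If F = `atMost w` is extended past m by F (m + u) = F u + m + 1, this and `atMost-unwrapped`
    -- both say that the rotated word has F (j + t) - F t letters at most j.
    atMost-wrapped : ∀ j u → u ≤ t → j + t ≡ m + u →
                     atMost (rotateWord t t′ w) j + atMost w t ≡ atMost w u + suc m
    atMost-wrapped j u u≤t eq = begin
      atMost (rotateWord t t′ w) j + atMost w t ≡⟨ lhs j ⟩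
      sum (λ i → rotated j i + ind (suc (pred (lookup w i)) ≤? t))
        ≡⟨ sum-cong-≗ (λ i → ind-wrapped {j = j} {u} (pred-letter-< w letters i) u≤t eq) ⟩
      sum (λ i → ind (suc (pred (lookup w i)) ≤? u) + 1)
        ≡⟨ sum-cong-≗ (λ i → cong (λ y → ind (y ≤? u) + 1) (letter-pred w letters i)) ⟩
      sum (λ i → ind (lookup w i ≤? u) + 1) ≡⟨ ∑-distrib-+ (λ i → ind (lookup w i ≤? u)) (λ _ → 1) ⟩
      sum (λ i → ind (lookup w i ≤? u)) + sum {suc m} (λ _ → 1)
        ≡⟨ cong₂ _+_ (sym (#-sum (λ i → lookup w i ≤? u))) (trans (sum-const (suc m) 1) (ℕ.*-identityʳ _)) ⟩
      atMost w u + suc m ∎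

-- Prime parking functions among the rotations of a word

module _ {m : ℕ} (1≤m : 1 ≤ m) where

  letters : List ℕ
  letters = map suc (upTo m)

  ∈-letters⁺ : ∀ {x} → 1 ≤ x × x ≤ m → x ∈ letters
  ∈-letters⁺ (s≤s _ , x≤m) = ∈-map⁺ suc (∈-upTo⁺ x≤m)

  ∈-letters⁻ : ∀ {x} → x ∈ letters → 1 ≤ x × x ≤ m
  ∈-letters⁻ x∈ with _ , y∈ , refl ← ∈-map⁻ suc x∈ = s≤s z≤n , ∈-upTo⁻ y∈

  length-letters : length letters ≡ m
  length-letters = trans (length-map suc (upTo m)) (length-upTo m)

  letters-unique : Unique letters
  letters-unique = Unique.map⁺ ℕ.suc-injective (Unique.upTo⁺ m)

  rotateWord-Letters : ∀ {t t′} (w : Vec ℕ (suc m)) → t + t′ ≡ m → Letters m w → Letters m (rotateWord t t′ w)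
  rotateWord-Letters {t} {t′} w t+t′≡m lw i = subst (λ x → 1 ≤ x × x ≤ m) (sym (lookup-rotateWord t+t′≡m w i))
    (s≤s z≤n , rotate-<m (t≤m t+t′≡m) (pred-letter-< w lw (rotateFin t′ i)))

  module _ {t t′ : ℕ} (t+t′≡m : t + t′ ≡ m) (t<m : t < m) (w : Vec ℕ (suc m)) (lw : Letters m w) where

    private
      F G : ℕ → ℕ
      F = atMost w
      G = atMost (rotateWord t t′ w)

    open ℕ.≤-Reasoning

    -- The bound G j ≥ j + 1 says F u - u > F t - t for u = j + t ≤ m. Past m, one period adds m + 1
    -- to F but m to the argument, so the strict inequality becomes the weak one at u = j + t - m.
    PrimeCounts⇒Good : PrimeCounts (rotateWord t t′ w) → Good F m t
    PrimeCounts⇒Good counts = later , earlier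
      where
      later : ∀ u → t < u → u ≤ m → F t + u < F u + t
      later u t<u u≤m = begin
        suc (F t + u)       ≡⟨ cong (λ v → suc (F t + v)) j+t≡u ⟨
        suc (F t + (j + t)) ≡⟨ regroup (F t) j t ⟩
        suc j + F t + t
          ≤⟨ ℕ.+-monoˡ-≤ t (ℕ.+-monoˡ-≤ (F t) (counts j (ℕ.m<n⇒0<n∸m t<u) (ℕ.≤-trans (ℕ.m∸n≤m u t) u≤m))) ⟩
        G j + F t + t
          ≡⟨ cong (_+ t) (atMost-unwrapped t+t′≡m w lw j (subst (_≤ m) (sym j+t≡u) u≤m)) ⟩
        F (j + t) + t ≡⟨ cong (λ v → F v + t) j+t≡u ⟩
        F u + t       ∎
        where
        j = u ∸ t
        j+t≡u : j + t ≡ u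
        j+t≡u = ℕ.m∸n+n≡m (ℕ.<⇒≤ t<u)
        regroup : ∀ a b c → suc (a + (b + c)) ≡ suc b + a + c
        regroup = ℕSolver.solve-∀
      earlier : ∀ u → u ≤ t → F t + u ≤ F u + t
      earlier u u≤t = ℕ.+-cancelʳ-≤ (suc m) _ _ (begin
        F t + u + suc m   ≡⟨ regroup₁ (F t) u m ⟩
        suc (m + u) + F t ≡⟨ cong (λ v → suc v + F t) j+t≡m+u ⟨
        suc (j + t) + F t ≡⟨ regroup₂ j t (F t) ⟩
        suc j + F t + t   ≤⟨ ℕ.+-monoˡ-≤ t (ℕ.+-monoˡ-≤ (F t) (counts j 1≤j j≤m)) ⟩
        G j + F t + t     ≡⟨ cong (_+ t) (atMost-wrapped t+t′≡m w lw j u u≤t j+t≡m+u) ⟩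
        F u + suc m + t   ≡⟨ regroup₃ (F u) (suc m) t ⟩
        F u + t + suc m   ∎)
        where
        t<m+u : t < m + u
        t<m+u = ℕ.<-≤-trans t<m (ℕ.m≤m+n m u)
        -- The j whose interval wraps around to u: t < m gives j ≥ 1 even for u = 0, and u ≤ t gives
        -- j ≤ m.
        j = m + u ∸ t
        j+t≡m+u : j + t ≡ m + u
        j+t≡m+u = ℕ.m∸n+n≡m (ℕ.<⇒≤ t<m+u)
        1≤j : 1 ≤ j
        1≤j = ℕ.m<n⇒0<n∸m t<m+u
        j≤m : j ≤ m
        j≤m = ℕ.+-cancelʳ-≤ t j m (subst (_≤ m + t) (sym j+t≡m+u) (ℕ.+-monoʳ-≤ m u≤t))
        regroup₁ : ∀ a b c → a + b + suc c ≡ suc (c + b) + a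
        regroup₁ = ℕSolver.solve-∀
        regroup₂ : ∀ a b c → suc (a + b) + c ≡ suc a + c + b
        regroup₂ = ℕSolver.solve-∀
        regroup₃ : ∀ a b c → a + b + c ≡ a + c + b
        regroup₃ = ℕSolver.solve-∀

    Good⇒PrimeCounts : Good F m t → PrimeCounts (rotateWord t t′ w)
    -- Values j with j + t ≤ m use the strict half of `Good`, the remaining ones the weak half.
    Good⇒PrimeCounts (later , earlier) j 1≤j j≤m with ℕ.≤-<-connex (j + t) m
    ... | inj₁ j+t≤m = ℕ.+-cancelʳ-≤ (F t + t) _ _ (begin
      suc j + (F t + t)   ≡⟨ regroup (F t) j t ⟨
      suc (F t + (j + t)) ≤⟨ later (j + t) (ℕ.+-monoˡ-≤ t 1≤j) j+t≤m ⟩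
      F (j + t) + t       ≡⟨ cong (_+ t) (atMost-unwrapped t+t′≡m w lw j j+t≤m) ⟨
      G j + F t + t       ≡⟨ ℕ.+-assoc (G j) (F t) t ⟩
      G j + (F t + t)     ∎)
      where
      regroup : ∀ a b c → suc (a + (b + c)) ≡ suc b + (a + c)
      regroup = ℕSolver.solve-∀
    ... | inj₂ m<j+t = ℕ.+-cancelʳ-≤ (F t + t) _ _ (begin
      suc j + (F t + t) ≡⟨ regroup₁ j (F t) t ⟩
      suc (j + t) + F t ≡⟨ cong (λ v → suc v + F t) m+u≡j+t ⟨
      suc (m + u) + F t ≡⟨ regroup₂ m u (F t) ⟩
      F t + u + suc m   ≤⟨ ℕ.+-monoˡ-≤ (suc m) (earlier u u≤t) ⟩
      F u + t + suc m   ≡⟨ regroup₃ (F u) t (suc m) ⟩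
      F u + suc m + t   ≡⟨ cong (_+ t) (atMost-wrapped t+t′≡m w lw j u u≤t (sym m+u≡j+t)) ⟨
      G j + F t + t     ≡⟨ ℕ.+-assoc (G j) (F t) t ⟩
      G j + (F t + t)   ∎)
      where
      u = j + t ∸ m
      m+u≡j+t : m + u ≡ j + t
      m+u≡j+t = ℕ.m+[n∸m]≡n (ℕ.<⇒≤ m<j+t)
      u≤t : u ≤ t
      u≤t = ℕ.+-cancelˡ-≤ m u t (subst (_≤ m + t) (sym m+u≡j+t) (ℕ.+-monoˡ-≤ t j≤m))
      regroup₁ : ∀ a b c → suc a + (b + c) ≡ suc (a + c) + b
      regroup₁ = ℕSolver.solve-∀
      regroup₂ : ∀ a b c → suc (a + b) + c ≡ c + b + suc a
      regroup₂ = ℕSolver.solve-∀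
      regroup₃ : ∀ a b c → a + b + c ≡ a + c + b
      regroup₃ = ℕSolver.solve-∀

  -- The bijection between tagged prime parking functions and words

  private
    W : List (Vec ℕ (suc m))
    W = words letters (suc m)

    -- For t < m this undoes the rotation by t, so the tag is the amount that rotates the resulting
    -- word to the prime parking function.
    unrotate : ℕ × Vec ℕ (suc m) → Vec ℕ (suc m)
    unrotate (t , w) = rotateWord (m ∸ t) t w

    tagged : List (ℕ × Vec ℕ (suc m))
    tagged = cartesianProduct (upTo m) (PPF (suc m))

  t+[m∸t]≡m : ∀ {t} → t < m → t + (m ∸ t) ≡ m
  t+[m∸t]≡m t<m = ℕ.m+[n∸m]≡n (ℕ.<⇒≤ t<m)

  [m∸t]+t≡m : ∀ {t} → t < m → (m ∸ t) + t ≡ m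
  [m∸t]+t≡m t<m = ℕ.m∸n+n≡m (ℕ.<⇒≤ t<m)

  ∈-PPF⇒prime : ∀ {w} → w ∈ PPF (suc m) → IsPrimeParking w
  ∈-PPF⇒prime = Equivalence.to ∈-PPF

  ∈-PPF⇒Letters : ∀ {w} → w ∈ PPF (suc m) → Letters m w
  ∈-PPF⇒Letters {w} w∈ = isPrimeParking⇒Letters 1≤m w (∈-PPF⇒prime w∈)

  -- Rotating the word by t returns the prime w. Hence the tag can be read off the word, as its last
  -- minimum.
  unrotate-Good : ∀ {t w} → t < m → w ∈ PPF (suc m) → Good (atMost (unrotate (t , w))) m t
  unrotate-Good {t} {w} t<m w∈ = PrimeCounts⇒Good (t+[m∸t]≡m t<m) t<m (unrotate (t , w))
    (rotateWord-Letters w ([m∸t]+t≡m t<m) (∈-PPF⇒Letters w∈))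
    (subst PrimeCounts (sym (rotateWord-inverse ([m∸t]+t≡m t<m) w (proj₁ ∘ ∈-PPF⇒Letters w∈)))
      (proj₂ (∈-PPF⇒prime w∈)))

  unrotate-cancel : ∀ {t v w} → t < m → v ∈ PPF (suc m) → w ∈ PPF (suc m) →
                    unrotate (t , v) ≡ unrotate (t , w) → v ≡ w
  unrotate-cancel {t} {v} {w} t<m v∈ w∈ eq = begin
    v
      ≡⟨ rotateWord-inverse ([m∸t]+t≡m t<m) v (proj₁ ∘ ∈-PPF⇒Letters v∈) ⟨
    rotateWord t (m ∸ t) (unrotate (t , v)) ≡⟨ cong (rotateWord t (m ∸ t)) eq ⟩
    rotateWord t (m ∸ t) (unrotate (t , w))
      ≡⟨ rotateWord-inverse ([m∸t]+t≡m t<m) w (proj₁ ∘ ∈-PPF⇒Letters w∈) ⟩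
    w                                       ∎
    where open ≡-Reasoning

  -- Equal words have the same last minimum, hence equal tags; then the common rotation is undone.
  unrotate-injective : ∀ {x y} → x ∈ tagged → y ∈ tagged → unrotate x ≡ unrotate y → x ≡ y
  unrotate-injective {t , v} {u , w} x∈ y∈ eq = pair (Good-unique (ℕ.<⇒≤ t<m) (ℕ.<⇒≤ u<m)
    (unrotate-Good t<m v∈) (subst (λ z → Good (atMost z) m u) (sym eq) (unrotate-Good u<m w∈)))
    where
    t<m : t < m
    t<m = ∈-upTo⁻ (proj₁ (∈-cartesianProduct⁻ (upTo m) (PPF (suc m)) x∈))
    u<m : u < m
    u<m = ∈-upTo⁻ (proj₁ (∈-cartesianProduct⁻ (upTo m) (PPF (suc m)) y∈))
    v∈ : v ∈ PPF (suc m)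
    v∈ = proj₂ (∈-cartesianProduct⁻ (upTo m) (PPF (suc m)) x∈)
    w∈ : w ∈ PPF (suc m)
    w∈ = proj₂ (∈-cartesianProduct⁻ (upTo m) (PPF (suc m)) y∈)
    pair : t ≡ u → (t , v) ≡ (u , w)
    pair refl = cong (t ,_) (unrotate-cancel t<m v∈ w∈ eq)

  unrotate-∈ : ∀ {x} → x ∈ tagged → unrotate x ∈ W
  unrotate-∈ {t , w} x∈ with t∈ , w∈ ← ∈-cartesianProduct⁻ (upTo m) (PPF (suc m)) x∈ =
    ∈-words _ (λ i → ∈-letters⁺ (rotateWord-Letters w ([m∸t]+t≡m (∈-upTo⁻ t∈)) (∈-PPF⇒Letters w∈) i))

  -- The last minimum of v serves as the tag, and v rotated by it is prime.
  unrotate-onto : ∀ {v} → v ∈ W → v ∈ map unrotate tagged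
  unrotate-onto {v} v∈ with last-argmin (atMost v) m
  ... | t , t≤m , good = subst (_∈ map unrotate tagged) (rotateWord-inverse (t+[m∸t]≡m t<m) v (proj₁ ∘ lv))
      (∈-map⁺ unrotate (∈-cartesianProduct⁺ (∈-upTo⁺ t<m) v′∈))
    where
    lv : Letters m v
    lv i = ∈-letters⁻ (∈-words⁻ v v∈ i)
    -- With F = `atMost v`, F m - m = 1 exceeds F 0 - 0 = 0, so the minimum is not at m.
    t≢m : t ≢ m
    t≢m refl = ℕ.<-irrefl refl (begin-strict
      m              <⟨ ℕ.n<1+n m ⟩
      suc m          ≡⟨ #-all (λ i → lookup v i ≤? m) (proj₂ ∘ lv) ⟨
      atMost v m     ≡⟨ ℕ.+-identityʳ _ ⟨
      atMost v m + 0 ≤⟨ proj₂ good 0 z≤n ⟩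
      atMost v 0 + m ≡⟨ cong (_+ m) (#-none (λ i → lookup v i ≤? 0) (λ i → ℕ.<⇒≱ (proj₁ (lv i)))) ⟩
      m              ∎)
      where open ℕ.≤-Reasoning
    t<m : t < m
    t<m = ℕ.≤∧≢⇒< t≤m t≢m
    v′ : Vec ℕ (suc m)
    v′ = rotateWord t (m ∸ t) v
    v′∈ : v′ ∈ PPF (suc m)
    v′∈ = Equivalence.from ∈-PPF (isPrimeParking⁺ 1≤m v′
      (λ i → proj₁ (rotateWord-Letters v (t+[m∸t]≡m t<m) lv i))
      (Good⇒PrimeCounts (t+[m∸t]≡m t<m) t<m v lv good))

  unrotate-↭ : map unrotate tagged ↭ W
  unrotate-↭ = unique-map-↭ (Unique.cartesianProduct⁺ (Unique.upTo⁺ m) (PPF-unique (suc m)))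
    (words-unique letters-unique (suc m)) unrotate-injective unrotate-∈ unrotate-onto

  -- The factor m counts the tags; the bijection preserves `fix`, so the tagged sum becomes the sum
  -- over all words.
  *-∑-PPF : ∀ k → + m *ᶻ coeff (∑ (PPF (suc m)) (λ w → q ^ fix w)) k ≡ coeff (∑ W (λ w → q ^ fix w)) k
  *-∑-PPF k = begin
    + m *ᶻ coeff S k               ≡⟨ cong (λ l → + l *ᶻ coeff S k) (length-upTo m) ⟨
    + length (upTo m) *ᶻ coeff S k ≡⟨ coeff-∑-const (upTo m) S k ⟨
    coeff (∑ (upTo m) (λ _ → S)) k
      ≡⟨ ∑-cartesianProductWith _,_ (upTo m) (PPF (suc m)) (λ x → q ^ fix (proj₂ x)) k ⟨
    coeff (∑ tagged (λ x → q ^ fix (proj₂ x))) k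
      ≡⟨ ∑-cong tagged _ _ (λ x∈ → ^-≡ (sym (fix-unrotate x∈))) k ⟩
    coeff (∑ tagged (λ x → q ^ fix (unrotate x))) k
      ≡⟨ cong (λ p → coeff p k) (∑-map unrotate tagged (λ w → q ^ fix w)) ⟨
    coeff (∑ (map unrotate tagged) (λ w → q ^ fix w)) k ≡⟨ ∑-↭ (λ w → q ^ fix w) unrotate-↭ k ⟩
    coeff (∑ W (λ w → q ^ fix w)) k                     ∎
    where
    open ≡-Reasoning
    S = ∑ (PPF (suc m)) (λ w → q ^ fix w)
    fix-unrotate : ∀ {x} → x ∈ tagged → fix (unrotate x) ≡ fix (proj₂ x)
    fix-unrotate {t , w} x∈ with t∈ , w∈ ← ∈-cartesianProduct⁻ (upTo m) (PPF (suc m)) x∈ =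
      fix-rotateWord ([m∸t]+t≡m (∈-upTo⁻ t∈)) w (proj₁ ∘ ∈-PPF⇒Letters w∈)

  ∑-fix : ∀ k → coeff (∑ W (λ w → q ^ fix w)) k ≡ + m *ᶻ coeff ((q +ₚ const (+ m - 1ℤ)) ^ m) k
  ∑-fix k = trans (∑-agree letters-unique (λ i → suc (toℕ i)) g∈ g∉ k)
    (cong (λ l → + l *ᶻ coeff ((q +ₚ const (+ l - 1ℤ)) ^ m) k) length-letters)
    where
    g∈ : ∀ i → suc (toℕ (inject₁ i)) ∈ letters
    g∈ i = ∈-letters⁺ (s≤s z≤n , subst (_< m) (sym (toℕ-inject₁ i)) (toℕ<n i))
    -- The last position has index m + 1, above every letter, and so is never fixed.
    g∉ : suc (toℕ (fromℕ m)) ∉ letters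
    g∉ m+1∈ = ℕ.<-irrefl (toℕ-fromℕ m) (proj₂ (∈-letters⁻ m+1∈))

theorem3p2 : (n : ℕ) → 2 ≤ n →
    ∑[ π ← PPF n ] (q ^ fix π) ≈ (q +ₚ const (+ n - + 2)) ^ (n ∸ 1)
-- Matching m as a successor makes it nonzero, so that the factor m can be cancelled in the
-- integers.
theorem3p2 (suc m@(suc _)) (s≤s 1≤m) k = ℤ.*-cancelˡ-≡ (+ m) _ _ (begin
  + m *ᶻ coeff (∑ (PPF (suc m)) (λ w → q ^ fix w)) k          ≡⟨ *-∑-PPF 1≤m k ⟩
  coeff (∑ (words (letters 1≤m) (suc m)) (λ w → q ^ fix w)) k ≡⟨ ∑-fix 1≤m k ⟩
  + m *ᶻ coeff ((q +ₚ const (+ m - 1ℤ)) ^ m) k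
    ≡⟨ cong (λ a → + m *ᶻ coeff ((q +ₚ const a) ^ m) k) (m-1≡1+m-2 (+ m)) ⟩
  + m *ᶻ coeff ((q +ₚ const (+ suc m - + 2)) ^ m) k ∎)
  where
  open ≡-Reasoning
  m-1≡1+m-2 : ∀ a → a - 1ℤ ≡ 1ℤ +ᶻ a - + 2
  m-1≡1+m-2 = ℤSolver.solve-∀
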